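{- Let $\mathcal A=(S,R)$ be an argumentation network with $S\neq\varnothing$, $R\subseteq S\times S$, which is finitary (every $y\in S$ has finitely many attackers). Write $\mathrm{Attack}(y)=\{z\mid zRy\}$ and regard the elements of $S$ as atoms of the logic $\mathbf{CN}$. Let $$\Delta_{\mathcal A}=\{x\mid x\in S,\ \neg\exists y\,(yRx)\}\cup\{y\leftrightarrow \textstyle\bigwedge_{z\in \mathrm{Attack}(y)}Nz\mid y\in S\}\cup\{z\to Ny\mid zRy\}\cup\{(\textstyle\bigwedge_{z\in\mathrm{Attack}(y)}\neg z)\wedge(\bigvee_{z\in\mathrm{Attack}(y)}\neg Nz)\to \neg y\wedge\neg Ny\mid y\in S\}$$ (empty conjunction is $\top$, empty disjunction is $\bot$). Then the $\mathbf{CN}$-models of $\Delta_{\mathcal A}$ correspond exactly to the complete extensions of $\mathcal A$: (i) for every $\mathbf{CN}$-model $h$ of $\Delta_{\mathcal A}$, the function $\lambda_h:S\to\{\mathrm{in},\mathrm{out},\mathrm{und}\}$ given by $\lambda_h(x)=\mathrm{in}$ if $h(x)=1$, $\lambda_h(x)=\mathrm{out}$ if $h(Nx)=1$, and $\lambda_h(x)=\mathrm{und}$ if $h(x)=h(Nx)=0$, is a well-defined legitimate Caminada labelling of $\mathcal A$; and (ii) for every legitimate Caminada labelling $\lambda$ of $\mathcal A$, the assignment $h_\lambda$ with $h_\lambda(x)=1$ iff $\lambda(x)=\mathrm{in}$ and $h_\lambda(Nx)=1$ iff $\lambda(x)=\mathrm{out}$ (for $x\in S$) is a $\mathbf{CN}$-model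 of $\Delta_{\mathcal A}$.
   Context: The logic $\mathbf{CN}$: atoms are $q$ and $Nq$ for $q$ in a set of basic atoms (here containing $S$); formulas are built with classical connectives; a $\mathbf{CN}$-model is a classical $\{0,1\}$-assignment $h$ to all atoms $q,Nq$ with $h(Nq)=1\Rightarrow h(q)=0$, with classical satisfaction; $\Delta\vdash_{\mathbf{CN}}A$ iff $\Delta\cup\{Nq\to\neg q\}\vdash A$ classically. A legitimate Caminada labelling of $(S,R)$ is a function $\lambda:S\to\{\mathrm{in},\mathrm{out},\mathrm{und}\}$ such that for all $x$: (C1) $\lambda(x)=\mathrm{in}$ iff every $y$ with $yRx$ has $\lambda(y)=\mathrm{out}$ (in particular if $x$ has no attackers); (C2) $\lambda(x)=\mathrm{out}$ iff some $y$ with $yRx$ has $\lambda(y)=\mathrm{in}$; (C3) $\lambda(x)=\mathrm{und}$ iff no attacker of $x$ is labelled in and some attacker of $x$ is labelled und. Complete extensions are the sets $\{x\mid\lambda(x)=\mathrm{in}\}$ for legitimate labellings $\lambda$, and this gives a bijection between legitimate labellings and complete extensions. -}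

module Defs where

open import Data.Bool.Base using (Bool; true; false; not; _∧_; _∨_)
open import Data.List.Base using (List; foldr; map)
open import Data.List.Membership.Propositional using (_∈_)
open import Data.Product.Base using (∃-syntax; _×_; proj₁)
open import Data.Sum.Base using (_⊎_; inj₁; inj₂)
open import Function.Bundles using (_⇔_)
open import Level using (Level; 0ℓ; _⊔_) renaming (suc to lsuc)
open import Relation.Binary.Core using (Rel)
open import Relation.Binary.PropositionalEquality.Core using (_≡_; _≢_)
open import Relation.Nullary.Negation.Core using (¬_)
open import Relation.Unary using (Pred; _≐_)

private
  variable
    a r q e : Level

data Atom (B : Set q) : Set q where
  pos : B → Atom B
  N   : B → Atom B

infix  30 `¬_
infixr 25 _`∧_
infixr 24 _`∨_
infixr 23 _`→_
infix  22 _`↔_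

data Formula (B : Set q) : Set q where
  atom           : Atom B → Formula B
  `⊤ `⊥          : Formula B
  `¬_            : Formula B → Formula B
  _`∧_ _`∨_      : Formula B → Formula B → Formula B
  _`→_ _`↔_      : Formula B → Formula B → Formula B

⋀ : {B : Set q} → List (Formula B) → Formula B
⋀ = foldr _`∧_ `⊤

⋁ : {B : Set q} → List (Formula B) → Formula B
⋁ = foldr _`∨_ `⊥

Assignment : Set q → Set q
Assignment B = Atom B → Bool

eval : {B : Set q} → Assignment B → Formula B → Bool
eval h (atom p)  = h p
eval h `⊤        = true
eval h `⊥        = false
eval h (`¬ A)    = not (eval h A)
eval h (A `∧ C)  = eval h A ∧ eval h C
eval h (A `∨ C)  = eval h A ∨ eval h C
eval h (A `→ C)  = not (eval h A) ∨ eval h C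
eval h (A `↔ C)  = (not (eval h A) ∨ eval h C) ∧ (not (eval h C) ∨ eval h A)

IsCNModel : {B : Set q} → Assignment B → Set q
IsCNModel h = ∀ b → h (N b) ≡ true → h (pos b) ≡ false

_⊨_ : {B : Set q} → Assignment B → Pred (Formula B) e → Set (q ⊔ e)
h ⊨ Γ = ∀ A → Γ A → eval h A ≡ true

IsCNModelOf : {B : Set q} → Pred (Formula B) e → Assignment B → Set (q ⊔ e)
IsCNModelOf Γ h = IsCNModel h × h ⊨ Γ

record ArgumentationNetwork (a r : Level) : Set (lsuc (a ⊔ r)) where
  field
    S         : Set a
    R         : Rel S r
    inhabited : S

open ArgumentationNetwork public

-- R A z y reads "z attacks y".  The list may repeat attackers: it only
-- has to have the attackers of y as its members.
Finitary : ArgumentationNetwork a r → Set (a ⊔ r)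
Finitary A = ∀ y → ∃[ zs ] (∀ z → z ∈ zs ⇔ R A z y)

Attack : (A : ArgumentationNetwork a r) → Finitary A → S A → List (S A)
Attack A fin y = proj₁ (fin y)

data Label : Set where
  In Out Und : Label

isIn : Label → Bool
isIn In  = true
isIn Out = false
isIn Und = false

isOut : Label → Bool
isOut In  = false
isOut Out = true
isOut Und = false

record IsLegitimate (A : ArgumentationNetwork a r) (L : S A → Label)
                    : Set (a ⊔ r) where
  field
    C1 : ∀ x → L x ≡ In  ⇔ (∀ y → R A y x → L y ≡ Out)
    C2 : ∀ x → L x ≡ Out ⇔ (∃[ y ] R A y x × L y ≡ In)
    C3 : ∀ x → L x ≡ Und ⇔ ((∀ y → R A y x → L y ≢ In)
                            × (∃[ y ] R A y x × L y ≡ Und))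

IsCompleteExtension : (A : ArgumentationNetwork a r) → Pred (S A) e →
                      Set (a ⊔ r ⊔ e)
IsCompleteExtension A E =
  ∃[ L ] IsLegitimate A L × E ≐ (λ x → L x ≡ In)

-- The basic atoms are the elements of S together
-- with a set Q of arbitrary further ones, so "a set of basic atoms
-- containing S" is S ⊎ Q.

BasicAtom : ArgumentationNetwork a r → Set q → Set (a ⊔ q)
BasicAtom A Q = S A ⊎ Q

data Δ (A : ArgumentationNetwork a r) (fin : Finitary A) (Q : Set q)
       : Pred (Formula (BasicAtom A Q)) (a ⊔ r ⊔ q) where

  unattacked : ∀ x → ¬ (∃[ y ] R A y x) →
    Δ A fin Q (atom (pos (inj₁ x)))

  in-iff : ∀ y →
    Δ A fin Q (atom (pos (inj₁ y))
               `↔ ⋀ (map (λ z → atom (N (inj₁ z))) (Attack A fin y)))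

  attack : ∀ z y → R A z y →
    Δ A fin Q (atom (pos (inj₁ z)) `→ atom (N (inj₁ y)))

  undecided : ∀ y →
    Δ A fin Q ((⋀ (map (λ z → `¬ atom (pos (inj₁ z))) (Attack A fin y))
                `∧ ⋁ (map (λ z → `¬ atom (N (inj₁ z))) (Attack A fin y)))
               `→ (`¬ atom (pos (inj₁ y)) `∧ `¬ atom (N (inj₁ y))))

module _ (A : ArgumentationNetwork a r) {Q : Set q} where

  LabelCondition : Assignment (BasicAtom A Q) → S A → Label → Set
  LabelCondition h x In  = h (pos (inj₁ x)) ≡ true
  LabelCondition h x Out = h (N (inj₁ x)) ≡ true
  LabelCondition h x Und = h (pos (inj₁ x)) ≡ false × h (N (inj₁ x)) ≡ false

  -- The three defining clauses of the labelling of h are exhaustive,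
  -- mutually exclusive, and define L.
  IsLabellingOf : Assignment (BasicAtom A Q) → (S A → Label) → Set a
  IsLabellingOf h L = ∀ x l → LabelCondition h x l ⇔ L x ≡ l

  -- A labelling says nothing about the atoms over Q; they are valued by g.
  assignment : (S A → Label) → Assignment Q → Assignment (BasicAtom A Q)
  assignment L g (pos (inj₁ x)) = isIn (L x)
  assignment L g (N (inj₁ x))   = isOut (L x)
  assignment L g (pos (inj₂ b)) = g (pos b)
  assignment L g (N (inj₂ b))   = g (N b)

  extension : Assignment (BasicAtom A Q) → Pred (S A) 0ℓ
  extension h x = h (pos (inj₁ x)) ≡ true

  AgreeOnS : Assignment (BasicAtom A Q) → Assignment (BasicAtom A Q) → Set a
  AgreeOnS h h′ = ∀ x → h (pos (inj₁ x)) ≡ h′ (pos (inj₁ x))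
                      × h (N (inj₁ x)) ≡ h′ (N (inj₁ x))

{-# OPTIONS --safe #-}
-- If h makes Nx true, then x has an attacker that is in: otherwise either all
-- attackers z of x have Nz true, and then x is true, against Nx → ¬x, or the last
-- formula of Δ makes Nx false.  Each of these case distinctions is on the finite
-- list of attackers, hence constructive.  So the values of h on the atoms Nx are
-- determined by its values on the atoms x.

module Submission where

open import Defs
open import Data.Bool.Base using (Bool; true; false; not; _∧_; _∨_)
open import Data.Bool.Properties using (¬-not; not-¬; not-injective)
open import Data.List.Base using ([]; _∷_; map)
open import Data.List.Membership.Propositional using (find; lose)
open import Data.List.Relation.Unary.All as All using (All; []; _∷_)
open import Data.List.Relation.Unary.Any using (Any; here; there)
open import Data.Product.Base using (∃-syntax; _×_; _,_; proj₁; proj₂)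
open import Data.Sum.Base using (_⊎_; inj₁; inj₂)
open import Data.Empty using (⊥-elim)
open import Function.Base using (_∘_)
open import Function.Bundles using (_⇔_; mk⇔; Equivalence)
open import Level using (Level; _⊔_)
open import Relation.Binary.PropositionalEquality using (_≡_; _≢_; refl; sym; trans; cong; cong₂)
open import Relation.Unary using (Pred; _≐_)

open Equivalence using (to; from)

true-or-false : ∀ b → b ≡ true ⊎ b ≡ false
true-or-false true  = inj₁ refl
true-or-false false = inj₂ refl

≡true-ext : ∀ {b c} → (b ≡ true → c ≡ true) → (c ≡ true → b ≡ true) → b ≡ c
≡true-ext {true}          f g = sym (f refl)
≡true-ext {false} {true}  f g = g refl
≡true-ext {false} {false} f g = refl

not≡true⇔ : ∀ {b} → not b ≡ true ⇔ b ≡ false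
not≡true⇔ = mk⇔ not-injective (cong not)

∧≡true⇔ : ∀ {b c} → b ∧ c ≡ true ⇔ (b ≡ true × c ≡ true)
∧≡true⇔ {b} {c} = mk⇔ (split b) (λ (p , q) → cong₂ _∧_ p q)
  where
  split : ∀ b → b ∧ c ≡ true → b ≡ true × c ≡ true
  split true eq = refl , eq

→≡true⇔ : ∀ {b c} → not b ∨ c ≡ true ⇔ (b ≡ true → c ≡ true)
→≡true⇔ {true}  = mk⇔ (λ eq _ → eq) (λ f → f refl)
→≡true⇔ {false} = mk⇔ (λ _ ()) (λ _ → refl)

module _ {b q} {B : Set b} {Q : Set q} (h : Assignment Q) (f : B → Formula Q) where

  eval-⋀⇔ : ∀ xs → eval h (⋀ (map f xs)) ≡ true ⇔ All (λ x → eval h (f x) ≡ true) xs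
  eval-⋀⇔ []       = mk⇔ (λ _ → []) (λ _ → refl)
  eval-⋀⇔ (x ∷ xs) = mk⇔
    (λ eq → let p , ps = to ∧≡true⇔ eq in p ∷ to (eval-⋀⇔ xs) ps)
    (λ { (p ∷ ps) → from ∧≡true⇔ (p , from (eval-⋀⇔ xs) ps) })

  eval-⋁⇔ : ∀ xs → eval h (⋁ (map f xs)) ≡ true ⇔ Any (λ x → eval h (f x) ≡ true) xs
  eval-⋁⇔ []       = mk⇔ (λ ()) (λ ())
  eval-⋁⇔ (x ∷ xs) with eval h (f x) in eq
  ... | true  = mk⇔ (λ _ → here eq) (λ _ → refl)
  ... | false = mk⇔ (there ∘ to (eval-⋁⇔ xs))
    λ { (here p)   → ⊥-elim (not-¬ eq p)
      ; (there ps) → from (eval-⋁⇔ xs) ps }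

-- The arguments are the values of `x` and `Nx`. The value at `true`, `true` is arbitrary, since a
-- CN-model never takes that pair.
label : Bool → Bool → Label
label true  _     = In
label false true  = Out
label false false = Und

isIn⇔ : ∀ l → isIn l ≡ true ⇔ l ≡ In
isIn⇔ In  = mk⇔ (λ _ → refl) (λ _ → refl)
isIn⇔ Out = mk⇔ (λ ()) (λ ())
isIn⇔ Und = mk⇔ (λ ()) (λ ())

isOut⇔ : ∀ l → isOut l ≡ true ⇔ l ≡ Out
isOut⇔ In  = mk⇔ (λ ()) (λ ())
isOut⇔ Out = mk⇔ (λ _ → refl) (λ _ → refl)
isOut⇔ Und = mk⇔ (λ ()) (λ ())

neither⇔ : ∀ l → (isIn l ≡ false × isOut l ≡ false) ⇔ l ≡ Und
neither⇔ In  = mk⇔ (λ ()) (λ ())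
neither⇔ Out = mk⇔ (λ ()) (λ ())
neither⇔ Und = mk⇔ (λ _ → refl) (λ _ → refl , refl)

module _ {a r q} (A : ArgumentationNetwork a r) {Q : Set q} where

  -- The content of `Δ` with quantifiers over `R` in place of connectives over lists. It separates
  -- the evaluation of formulas from the comparison with C1, C2 and C3.
  record Clauses (h : Assignment (BasicAtom A Q)) : Set (a ⊔ r) where
    field
      in-iff-N  : ∀ y → h (pos (inj₁ y)) ≡ true ⇔ (∀ z → R A z y → h (N (inj₁ z)) ≡ true)
      attack-N  : ∀ z y → R A z y → h (pos (inj₁ z)) ≡ true → h (N (inj₁ y)) ≡ true
      und-false : ∀ y → (∀ z → R A z y → h (pos (inj₁ z)) ≡ false) →
                  ∃[ z ] R A z y × h (N (inj₁ z)) ≡ false →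
                  h (pos (inj₁ y)) ≡ false × h (N (inj₁ y)) ≡ false

  -- The CN condition excludes the row where `x` and `Nx` are both true. In each of the other three
  -- rows exactly one label condition holds.
  isLabelling : ∀ (h : Assignment (BasicAtom A Q)) → IsCNModel h → IsLabellingOf A h (λ x → label (h (pos (inj₁ x))) (h (N (inj₁ x))))
  isLabelling h cn x l with h (pos (inj₁ x)) in p | h (N (inj₁ x)) in n
  isLabelling h cn x l   | true  | true  = ⊥-elim (not-¬ (cn (inj₁ x) n) p)
  isLabelling h cn x In  | true  | false = mk⇔ (λ _ → refl) (λ _ → p)
  isLabelling h cn x Out | true  | false = mk⇔ (λ e → ⊥-elim (not-¬ n e)) (λ ())
  isLabelling h cn x Und | true  | false = mk⇔ (λ (e , _) → ⊥-elim (not-¬ e p)) (λ ())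
  isLabelling h cn x In  | false | true  = mk⇔ (λ e → ⊥-elim (not-¬ p e)) (λ ())
  isLabelling h cn x Out | false | true  = mk⇔ (λ _ → refl) (λ _ → n)
  isLabelling h cn x Und | false | true  = mk⇔ (λ (_ , e) → ⊥-elim (not-¬ e n)) (λ ())
  isLabelling h cn x In  | false | false = mk⇔ (λ e → ⊥-elim (not-¬ p e)) (λ ())
  isLabelling h cn x Out | false | false = mk⇔ (λ e → ⊥-elim (not-¬ n e)) (λ ())
  isLabelling h cn x Und | false | false = mk⇔ (λ _ → refl) (λ _ → p , n)

  assignment-isCNModel : ∀ L (g : Assignment Q) → IsCNModel g → IsCNModel (assignment A L g)
  assignment-isCNModel L g cn (inj₂ b) = cn b
  assignment-isCNModel L g cn (inj₁ x) with L x
  -- For `In` and `Und` the premise that `isOut` is `true` is absurd.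
  ... | Out = λ _ → refl

  assignment-isLabelling : ∀ L (g : Assignment Q) → IsLabellingOf A (assignment A L g) L
  assignment-isLabelling L g x In  = isIn⇔ (L x)
  assignment-isLabelling L g x Out = isOut⇔ (L x)
  assignment-isLabelling L g x Und = neither⇔ (L x)

  -- Read through `lab`, C1 is `in-iff-N`, and the right-to-left halves of C2 and C3 give `attack-N`
  -- and `und-false`.
  IsLegitimate⇒Clauses : ∀ {h L} → IsLabellingOf A h L → IsLegitimate A L → Clauses h
  IsLegitimate⇒Clauses lab leg = record
    { in-iff-N  = λ y → mk⇔
        (λ p z zRy → from (lab z Out) (to (C1 y) (to (lab y In) p) z zRy))
        (λ out → from (lab y In) (from (C1 y) λ z zRy → to (lab z Out) (out z zRy)))
    ; attack-N  = λ z y zRy p → from (lab y Out) (from (C2 y) (z , zRy , to (lab z In) p))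
    ; und-false = λ y noIn (z , zRy , n) → from (lab y Und) (from (C3 y)
        ( (λ w wRy e → not-¬ (noIn w wRy) (from (lab w In) e))
        , z , zRy , to (lab z Und) (noIn z zRy , n)))
    }
    where open IsLegitimate leg

  module _ (fin : Finitary A) where

    -- `R` itself may be undecidable; the dichotomy is decided by running the Boolean test along the
    -- list of attackers, where repetitions do no harm.
    all-or-some : ∀ (p : S A → Bool) y →
      (∀ z → R A z y → p z ≡ true) ⊎ (∃[ z ] R A z y × p z ≡ false)
    all-or-some p y with All.decide (true-or-false ∘ p) (Attack A fin y)
    ... | inj₁ all = inj₁ λ z zRy → All.lookup all (from (proj₂ (fin y) z) zRy)
    ... | inj₂ any = let z , z∈ , eq = find any in inj₂ (z , to (proj₂ (fin y) z) z∈ , eq)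

    module _ (h : Assignment (BasicAtom A Q)) where

      eval-⋀-Attack⇔ : ∀ f y → eval h (⋀ (map f (Attack A fin y))) ≡ true ⇔
                       (∀ z → R A z y → eval h (f z) ≡ true)
      eval-⋀-Attack⇔ f y = mk⇔
        (λ eq z zRy → All.lookup (to (eval-⋀⇔ h f _) eq) (from (proj₂ (fin y) z) zRy))
        (λ all → from (eval-⋀⇔ h f _) (All.tabulate λ {z} z∈ → all z (to (proj₂ (fin y) z) z∈)))

      eval-⋁-Attack⇔ : ∀ f y → eval h (⋁ (map f (Attack A fin y))) ≡ true ⇔
                       (∃[ z ] R A z y × eval h (f z) ≡ true)
      eval-⋁-Attack⇔ f y = mk⇔
        (λ eq → let z , z∈ , p = find (to (eval-⋁⇔ h f _) eq) in z , to (proj₂ (fin y) z) z∈ , p)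
        (λ (z , zRy , p) → from (eval-⋁⇔ h f _) (lose (from (proj₂ (fin y) z) zRy) p))

      ⊨Δ⇔Clauses : (h ⊨ Δ A fin Q) ⇔ Clauses h
      ⊨Δ⇔Clauses = mk⇔ forth back
        where
        forth : h ⊨ Δ A fin Q → Clauses h
        forth m = record
          { in-iff-N  = λ y → let l , r = to ∧≡true⇔ (m _ (in-iff y)) in mk⇔
              (to (eval-⋀-Attack⇔ _ y) ∘ to →≡true⇔ l)
              (to →≡true⇔ r ∘ from (eval-⋀-Attack⇔ _ y))
          ; attack-N  = λ z y zRy → to →≡true⇔ (m _ (attack z y zRy))
          ; und-false = λ y noIn (z , zRy , n) →
              let p , q = to ∧≡true⇔ (to →≡true⇔ (m _ (undecided y)) (from ∧≡true⇔
                    ( from (eval-⋀-Attack⇔ _ y) (λ w wRy → cong not (noIn w wRy))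
                    , from (eval-⋁-Attack⇔ _ y) (z , zRy , cong not n))))
              in to not≡true⇔ p , to not≡true⇔ q
          }

        back : Clauses h → h ⊨ Δ A fin Q
        back c = sat
          where
          open Clauses c
          sat : h ⊨ Δ A fin Q
          -- Without attackers the right side of `in-iff-N` holds vacuously.
          sat _ (unattacked x none) = from (in-iff-N x) λ z zRx → ⊥-elim (none (z , zRx))
          sat _ (in-iff y)          = from ∧≡true⇔
            ( from →≡true⇔ (from (eval-⋀-Attack⇔ _ y) ∘ to (in-iff-N y))
            , from →≡true⇔ (from (in-iff-N y) ∘ to (eval-⋀-Attack⇔ _ y)))
          sat _ (attack z y zRy)    = from →≡true⇔ (attack-N z y zRy)
          sat _ (undecided y)       = from →≡true⇔ λ eq →
            let noIn , someN      = to ∧≡true⇔ eq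
                z , zRy , n       = to (eval-⋁-Attack⇔ _ y) someN
                p , q             = und-false y
                  (λ w wRy → to not≡true⇔ (to (eval-⋀-Attack⇔ _ y) noIn w wRy))
                  (z , zRy , to not≡true⇔ n)
            in from ∧≡true⇔ (cong not p , cong not q)

    module _ {h : Assignment (BasicAtom A Q)} {L} (lab : IsLabellingOf A h L) where

      -- C1 and the right-to-left halves of C2 and C3 are the clauses translated by `lab`. The
      -- left-to-right halves must produce an attacker, which is found by `all-or-some`.
      Clauses⇒IsLegitimate : Clauses h → IsLegitimate A L
      Clauses⇒IsLegitimate c = record
        { C1 = λ x → mk⇔
            (λ e y yRx → to (lab y Out) (to (in-iff-N x) (from (lab x In) e) y yRx))
            (λ out → to (lab x In) (from (in-iff-N x) λ y yRx → from (lab y Out) (out y yRx)))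
        ; C2 = λ x → mk⇔ (someIn x)
            (λ (y , yRx , e) → to (lab x Out) (attack-N y x yRx (from (lab y In) e)))
        ; C3 = λ x → mk⇔ (someUnd x)
            (λ (noIn , y , yRx , e) → to (lab x Und) (und-false x
              (λ z zRx → ¬-not (noIn z zRx ∘ to (lab z In)))
              (y , yRx , proj₂ (from (lab y Und) e))))
        }
        where
        open Clauses c

        someIn : ∀ x → L x ≡ Out → ∃[ y ] R A y x × L y ≡ In
        -- The test is negated because `all-or-some` returns a witness where the test fails, and the
        -- attacker sought is a true one.
        someIn x e with all-or-some (λ z → not (h (pos (inj₁ z)))) x
        ... | inj₂ (y , yRx , p) = y , yRx , to (lab y In) (not-injective p)
        ... | inj₁ noIn with all-or-some (λ z → h (N (inj₁ z))) x
        ...   | inj₁ allOut with () ← trans (sym e) (to (lab x In) (from (in-iff-N x) allOut))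
        ...   | inj₂ some = ⊥-elim (not-¬
          (proj₂ (und-false x (λ z zRx → to not≡true⇔ (noIn z zRx)) some))
          (from (lab x Out) e))

        -- Since `x` is false, some attacker `y` has `Ny` false. Since `Nx` is false, `attack-N`
        -- forbids a true attacker, so `y` is false as well and hence undecided.
        someUnd : ∀ x → L x ≡ Und →
                  (∀ y → R A y x → L y ≢ In) × (∃[ y ] R A y x × L y ≡ Und)
        someUnd x e with from (lab x Und) e | all-or-some (λ z → h (N (inj₁ z))) x
        ... | p , n | inj₁ allOut       = ⊥-elim (not-¬ p (from (in-iff-N x) allOut))
        ... | p , n | inj₂ (y , yRx , m) =
          noIn , y , yRx , to (lab y Und) (¬-not (noIn y yRx ∘ to (lab y In)) , m)
          where
          noIn = λ z zRx e → not-¬ n (attack-N z x zRx (from (lab z In) e))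

    labelling : ∀ h → IsCNModelOf (Δ A fin Q) h → ∃[ L ] IsLabellingOf A h L × IsLegitimate A L
    labelling h (cn , m) =
      _ , isLabelling h cn , Clauses⇒IsLegitimate (isLabelling h cn) (to (⊨Δ⇔Clauses h) m)

    assignment-isModel : ∀ L → IsLegitimate A L → ∀ (g : Assignment Q) → IsCNModel g →
                         IsCNModelOf (Δ A fin Q) (assignment A L g)
    assignment-isModel L leg g cn =
      assignment-isCNModel L g cn ,
      from (⊨Δ⇔Clauses _) (IsLegitimate⇒Clauses (assignment-isLabelling L g) leg)

    -- This is C2 for the labelling of `h`, carried back to truth values.
    N⇔attacked : ∀ h → IsCNModelOf (Δ A fin Q) h → ∀ x →
                 h (N (inj₁ x)) ≡ true ⇔ (∃[ y ] R A y x × h (pos (inj₁ y)) ≡ true)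
    N⇔attacked h m x with labelling h m
    ... | L , lab , leg = mk⇔
      (λ n → let y , yRx , e = to (C2 x) (to (lab x Out) n) in y , yRx , from (lab y In) e)
      (λ (y , yRx , p) → from (lab x Out) (from (C2 x) (y , yRx , to (lab y In) p)))
      where open IsLegitimate leg

    -- Equal extensions have the same true attackers, so `N⇔attacked` transfers the values of the
    -- atoms `Nx`. Agreement stops at `S` because `Δ` does not mention the atoms over `Q`.
    extension-determines : ∀ h h′ → IsCNModelOf (Δ A fin Q) h → IsCNModelOf (Δ A fin Q) h′ →
                           extension A h ≐ extension A h′ → AgreeOnS A h h′
    extension-determines h h′ m m′ (⊆ , ⊇) x =
      ≡true-ext ⊆ ⊇ ,
      ≡true-ext
        (λ n → let y , yRx , p = to (N⇔attacked h m x) n in from (N⇔attacked h′ m′ x) (y , yRx , ⊆ p))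
        (λ n → let y , yRx , p = to (N⇔attacked h′ m′ x) n in from (N⇔attacked h m x) (y , yRx , ⊇ p))

-- The last three components say that `extension` is well defined, injective up to `AgreeOnS`, and
-- surjective onto the complete extensions up to `≐`.
theorem5 : ∀ {a r q e : Level}
    (A : ArgumentationNetwork a r) (fin : Finitary A) (Q : Set q) →
    (∀ h → IsCNModelOf (Δ A fin Q) h →
    ∃[ L ] IsLabellingOf A h L × IsLegitimate A L)
    × (∀ L → IsLegitimate A L →
    ∀ g → IsCNModel g →
    IsCNModelOf (Δ A fin Q) (assignment A L g))
    × (∀ h → IsCNModelOf (Δ A fin Q) h →
    IsCompleteExtension A (extension A h))
    × (∀ h h′ → IsCNModelOf (Δ A fin Q) h → IsCNModelOf (Δ A fin Q) h′ →
    extension A h ≐ extension A h′ →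
    AgreeOnS A h h′)
    × (∀ (E : Pred (S A) e) → IsCompleteExtension A E →
    ∃[ h ] IsCNModelOf (Δ A fin Q) h × E ≐ extension A h)
theorem5 A fin Q =
  labelling A fin ,
  assignment-isModel A fin ,
  (λ h m → let L , lab , leg = labelling A fin h m in
    L , leg , (λ {x} → to (lab x In)) , λ {x} → from (lab x In)) ,
  extension-determines A fin ,
  λ E (L , leg , ⊆ , ⊇) →
    -- Any CN-model over `Q` would serve; the constant `false` satisfies the CN condition vacuously.
    let g   : Assignment Q
        g   = λ _ → false
        lab = assignment-isLabelling A {Q} L g
    in assignment A L g , assignment-isModel A fin L leg g (λ _ ()) ,
       (λ {x} → from (lab x In) ∘ ⊆) , λ {x} → ⊇ ∘ to (lab x In)
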